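{- Let $D=\mathbb{Z}[\omega]$ with $\omega=\frac{ -1+i\sqrt{3}}{2}$, and let $\pi\in D$ be a prime. Then the residue class ring $D/\pi D$ is a finite field with $N\pi$ elements.
   Context: For $\alpha=a+b\omega\in D$ with $a,b\in\mathbb{Z}$, the norm is $N\alpha=\alpha\overline{\alpha}=a^2-ab+b^2$. -}

module Defs where

open import Algebra.Bundles using (CommutativeRing)
import Algebra.Definitions as Definitions
import Algebra.Properties.CommutativeSemigroup as CommutativeSemigroupProperties
import Algebra.Properties.Ring as RingProperties
import Algebra.Properties.Semiring.Divisibility as SemiringDivisibility
import Algebra.Properties.Semiring.Primality as SemiringPrimality
open import Data.Fin.Base using (Fin)
open import Data.Integer.Base as ℤ using (ℤ; 0ℤ; 1ℤ)
import Data.Integer.Properties as ℤ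
open import Data.Integer.Tactic.RingSolver using (solve-∀)
open import Data.Nat.Base using (ℕ)
open import Data.Product.Base using (_,_)
open import Function.Bundles using (Bijection)
open import Level using (Level; _⊔_; 0ℓ)
open import Relation.Binary.Bundles using (Setoid)
import Relation.Binary.PropositionalEquality as ≡
open ≡ using (_≡_; refl; cong₂)
import Relation.Binary.Reasoning.Setoid as SetoidReasoning

private
  variable
    c ℓ : Level

-- The library only has Heyting fields, which carry an apartness relation.

record IsField (R : CommutativeRing c ℓ) : Set (c ⊔ ℓ) where
  open CommutativeRing R
  open Definitions _≈_ using (Invertible)
  field
    1≉0        : 1# ≉ 0#
    invertible : ∀ x → x ≉ 0# → Invertible 1# _*_ x

HasCardinality : Setoid c ℓ → ℕ → Set (c ⊔ ℓ)
HasCardinality S n = Bijection (≡.setoid (Fin n)) S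

-- R / pR: the elements of R, with equality replaced by congruence modulo p.

module _ (R : CommutativeRing c ℓ) (p : CommutativeRing.Carrier R) where

  open CommutativeRing R
  open SemiringDivisibility semiring using (_∣_; _,_; _∣0; ∣-respʳ-≈; x∣ʳy⇒x∣ʳzy)
  open RingProperties ring
    using (-‿distribˡ-*; -‿+-comm; ⁻¹-anti-homo‿-; x[y-z]≈xy-xz; x≈y⇒x∙y⁻¹≈ε)
  open CommutativeSemigroupProperties +-commutativeSemigroup using (interchange)
  open SetoidReasoning setoid

  _≡ₚ_ : Carrier → Carrier → Set (c ⊔ ℓ)
  x ≡ₚ y = p ∣ (x - y)

  private
    ∣-+ : ∀ {x y} → p ∣ x → p ∣ y → p ∣ (x + y)
    ∣-+ (q , qp≈x) (r , rp≈y) =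
      (q + r) , trans (distribʳ p q r) (+-cong qp≈x rp≈y)

    ∣-neg : ∀ {x} → p ∣ x → p ∣ (- x)
    ∣-neg (q , qp≈x) =
      (- q) , trans (sym (-‿distribˡ-* q p)) (-‿cong qp≈x)

    sub-add-sub : ∀ x y z → (x - y) + (y - z) ≈ x - z
    sub-add-sub x y z = begin
      (x - y) + (y - z)     ≈⟨ +-assoc x (- y) (y - z) ⟩
      x + (- y + (y - z))   ≈⟨ +-congˡ (+-assoc (- y) y (- z)) ⟨
      x + ((- y + y) - z)   ≈⟨ +-congˡ (+-congʳ (-‿inverseˡ y)) ⟩
      x + (0# - z)          ≈⟨ +-congˡ (+-identityˡ (- z)) ⟩
      x - z                 ∎

    ≈⇒≡ₚ : ∀ {x y} → x ≈ y → x ≡ₚ y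
    ≈⇒≡ₚ x≈y = ∣-respʳ-≈ (sym (x≈y⇒x∙y⁻¹≈ε x≈y)) (p ∣0)

    ≡ₚ-sym : ∀ {x y} → x ≡ₚ y → y ≡ₚ x
    ≡ₚ-sym {x} {y} x≡y = ∣-respʳ-≈ (⁻¹-anti-homo‿- x y) (∣-neg x≡y)

    ≡ₚ-trans : ∀ {x y z} → x ≡ₚ y → y ≡ₚ z → x ≡ₚ z
    ≡ₚ-trans {x} {y} {z} x≡y y≡z = ∣-respʳ-≈ (sub-add-sub x y z) (∣-+ x≡y y≡z)

    +-cong-≡ₚ : ∀ {x x′ y y′} → x ≡ₚ x′ → y ≡ₚ y′ → (x + y) ≡ₚ (x′ + y′)
    +-cong-≡ₚ {x} {x′} {y} {y′} x≡x′ y≡y′ = ∣-respʳ-≈ (begin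
      (x - x′) + (y - y′)       ≈⟨ interchange x (- x′) y (- y′) ⟩
      (x + y) + (- x′ + - y′)   ≈⟨ +-congˡ (-‿+-comm x′ y′) ⟩
      (x + y) - (x′ + y′)       ∎) (∣-+ x≡x′ y≡y′)

    -‿cong-≡ₚ : ∀ {x y} → x ≡ₚ y → (- x) ≡ₚ (- y)
    -‿cong-≡ₚ {x} {y} x≡y = ∣-respʳ-≈ (sym (-‿+-comm x (- y))) (∣-neg x≡y)

    *-cong-≡ₚ : ∀ {x x′ y y′} → x ≡ₚ x′ → y ≡ₚ y′ → (x * y) ≡ₚ (x′ * y′)
    *-cong-≡ₚ {x} {x′} {y} {y′} x≡x′ y≡y′ = ≡ₚ-trans
      (∣-respʳ-≈ (x[y-z]≈xy-xz x y y′) (x∣ʳy⇒x∣ʳzy x y≡y′))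
      (∣-respʳ-≈ (begin
        y′ * (x - x′)     ≈⟨ x[y-z]≈xy-xz y′ x x′ ⟩
        y′ * x - y′ * x′  ≈⟨ +-cong (*-comm y′ x) (-‿cong (*-comm y′ x′)) ⟩
        x * y′ - x′ * y′  ∎) (x∣ʳy⇒x∣ʳzy y′ x≡x′))

  residueClassRing : CommutativeRing c (c ⊔ ℓ)
  residueClassRing = record
    { Carrier = Carrier
    ; _≈_     = _≡ₚ_
    ; _+_     = _+_
    ; _*_     = _*_
    ; -_      = -_
    ; 0#      = 0#
    ; 1#      = 1#
    ; isCommutativeRing = record
      { isRing = record
        { +-isAbelianGroup = record
          { isGroup = record
            { isMonoid = record
              { isSemigroup = record
                { isMagma = record
                  { isEquivalence = record
                    { refl = ≈⇒≡ₚ refl′ ; sym = ≡ₚ-sym ; trans = ≡ₚ-trans }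
                  ; ∙-cong = +-cong-≡ₚ
                  }
                ; assoc = λ x y z → ≈⇒≡ₚ (+-assoc x y z)
                }
              ; identity = (λ x → ≈⇒≡ₚ (+-identityˡ x))
                         , (λ x → ≈⇒≡ₚ (+-identityʳ x))
              }
            ; inverse = (λ x → ≈⇒≡ₚ (-‿inverseˡ x))
                      , (λ x → ≈⇒≡ₚ (-‿inverseʳ x))
            ; ⁻¹-cong = -‿cong-≡ₚ
            }
          ; comm = λ x y → ≈⇒≡ₚ (+-comm x y)
          }
        ; *-cong     = *-cong-≡ₚ
        ; *-assoc    = λ x y z → ≈⇒≡ₚ (*-assoc x y z)
        ; *-identity = (λ x → ≈⇒≡ₚ (*-identityˡ x))
                     , (λ x → ≈⇒≡ₚ (*-identityʳ x))
        ; distrib    = (λ x y z → ≈⇒≡ₚ (distribˡ x y z))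
                     , (λ x y z → ≈⇒≡ₚ (distribʳ x y z))
        }
      ; *-comm = λ x y → ≈⇒≡ₚ (*-comm x y)
      }
    }
    where
    refl′ : ∀ {x} → x ≈ x
    refl′ = CommutativeRing.refl R

-- a +ω b stands for the complex number a + bω, ω = (-1 + i√3)/2. As 1 and ω
-- are linearly independent over ℚ, a and b are unique, so _≡_ is the right
-- equality. Multiplication is the complex one, expanded using ω² = -1 - ω.

infix 5 _+ω_

record ℤ[ω] : Set where
  constructor _+ω_
  field
    coeff-1 : ℤ
    coeff-ω : ℤ

infixl 6 _+ᴰ_
infixl 7 _*ᴰ_
infix  8 -ᴰ_

_+ᴰ_ : ℤ[ω] → ℤ[ω] → ℤ[ω]
(a +ω b) +ᴰ (c +ω d) = (a ℤ.+ c) +ω (b ℤ.+ d)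

_*ᴰ_ : ℤ[ω] → ℤ[ω] → ℤ[ω]
(a +ω b) *ᴰ (c +ω d) =
  (a ℤ.* c ℤ.- b ℤ.* d) +ω (a ℤ.* d ℤ.+ b ℤ.* c ℤ.- b ℤ.* d)

-ᴰ_ : ℤ[ω] → ℤ[ω]
-ᴰ (a +ω b) = (ℤ.- a) +ω (ℤ.- b)

0ᴰ 1ᴰ ω : ℤ[ω]
0ᴰ = 0ℤ +ω 0ℤ
1ᴰ = 1ℤ +ω 0ℤ
ω  = 0ℤ +ω 1ℤ

-- The conjugate of ω is ω² = -1 - ω.
conj : ℤ[ω] → ℤ[ω]
conj (a +ω b) = (a ℤ.- b) +ω (ℤ.- b)

N : ℤ[ω] → ℤ
N (a +ω b) = a ℤ.* a ℤ.- a ℤ.* b ℤ.+ b ℤ.* b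

α*conjα≡Nα : ∀ α → α *ᴰ conj α ≡ N α +ω 0ℤ
α*conjα≡Nα (a +ω b) = cong₂ _+ω_ (lemma₁ a b) (lemma₂ a b)
  where
  lemma₁ : ∀ a b → a ℤ.* (a ℤ.- b) ℤ.- b ℤ.* (ℤ.- b)
                 ≡ a ℤ.* a ℤ.- a ℤ.* b ℤ.+ b ℤ.* b
  lemma₁ = solve-∀
  lemma₂ : ∀ a b → a ℤ.* (ℤ.- b) ℤ.+ b ℤ.* (a ℤ.- b) ℤ.- b ℤ.* (ℤ.- b) ≡ 0ℤ
  lemma₂ = solve-∀

-- 2ω + 1 plays the role of i√3.
[2ω+1]²≡-3 : (ω +ᴰ ω +ᴰ 1ᴰ) *ᴰ (ω +ᴰ ω +ᴰ 1ᴰ) ≡ ℤ.-[1+ 2 ] +ω 0ℤ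
[2ω+1]²≡-3 = refl

private
  +-assocᴰ : ∀ x y z → (x +ᴰ y) +ᴰ z ≡ x +ᴰ (y +ᴰ z)
  +-assocᴰ (a +ω b) (c +ω d) (e +ω f) =
    cong₂ _+ω_ (ℤ.+-assoc a c e) (ℤ.+-assoc b d f)

  +-commᴰ : ∀ x y → x +ᴰ y ≡ y +ᴰ x
  +-commᴰ (a +ω b) (c +ω d) = cong₂ _+ω_ (ℤ.+-comm a c) (ℤ.+-comm b d)

  +-identityˡᴰ : ∀ x → 0ᴰ +ᴰ x ≡ x
  +-identityˡᴰ (a +ω b) = cong₂ _+ω_ (ℤ.+-identityˡ a) (ℤ.+-identityˡ b)

  -‿inverseˡᴰ : ∀ x → (-ᴰ x) +ᴰ x ≡ 0ᴰ
  -‿inverseˡᴰ (a +ω b) = cong₂ _+ω_ (ℤ.+-inverseˡ a) (ℤ.+-inverseˡ b)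

  *-commᴰ : ∀ x y → x *ᴰ y ≡ y *ᴰ x
  *-commᴰ (a +ω b) (c +ω d) = cong₂ _+ω_ (lemma₁ a b c d) (lemma₂ a b c d)
    where
    lemma₁ : ∀ a b c d → a ℤ.* c ℤ.- b ℤ.* d ≡ c ℤ.* a ℤ.- d ℤ.* b
    lemma₁ = solve-∀
    lemma₂ : ∀ a b c d → a ℤ.* d ℤ.+ b ℤ.* c ℤ.- b ℤ.* d
                       ≡ c ℤ.* b ℤ.+ d ℤ.* a ℤ.- d ℤ.* b
    lemma₂ = solve-∀

  *-identityˡᴰ : ∀ x → 1ᴰ *ᴰ x ≡ x
  *-identityˡᴰ (a +ω b) = cong₂ _+ω_ (lemma₁ a b) (lemma₂ a b)
    where
    lemma₁ : ∀ a b → 1ℤ ℤ.* a ℤ.- 0ℤ ℤ.* b ≡ a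
    lemma₁ = solve-∀
    lemma₂ : ∀ a b → 1ℤ ℤ.* b ℤ.+ 0ℤ ℤ.* a ℤ.- 0ℤ ℤ.* b ≡ b
    lemma₂ = solve-∀

  *-assocᴰ : ∀ x y z → (x *ᴰ y) *ᴰ z ≡ x *ᴰ (y *ᴰ z)
  *-assocᴰ (a +ω b) (c +ω d) (e +ω f) =
    cong₂ _+ω_ (lemma₁ a b c d e f) (lemma₂ a b c d e f)
    where
    lemma₁ : ∀ a b c d e f →
      (a ℤ.* c ℤ.- b ℤ.* d) ℤ.* e ℤ.- (a ℤ.* d ℤ.+ b ℤ.* c ℤ.- b ℤ.* d) ℤ.* f
      ≡ a ℤ.* (c ℤ.* e ℤ.- d ℤ.* f) ℤ.- b ℤ.* (c ℤ.* f ℤ.+ d ℤ.* e ℤ.- d ℤ.* f)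
    lemma₁ = solve-∀
    lemma₂ : ∀ a b c d e f →
      (a ℤ.* c ℤ.- b ℤ.* d) ℤ.* f ℤ.+ (a ℤ.* d ℤ.+ b ℤ.* c ℤ.- b ℤ.* d) ℤ.* e
        ℤ.- (a ℤ.* d ℤ.+ b ℤ.* c ℤ.- b ℤ.* d) ℤ.* f
      ≡ a ℤ.* (c ℤ.* f ℤ.+ d ℤ.* e ℤ.- d ℤ.* f) ℤ.+ b ℤ.* (c ℤ.* e ℤ.- d ℤ.* f)
        ℤ.- b ℤ.* (c ℤ.* f ℤ.+ d ℤ.* e ℤ.- d ℤ.* f)
    lemma₂ = solve-∀

  distribˡᴰ : ∀ x y z → x *ᴰ (y +ᴰ z) ≡ (x *ᴰ y) +ᴰ (x *ᴰ z)
  distribˡᴰ (a +ω b) (c +ω d) (e +ω f) =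
    cong₂ _+ω_ (lemma₁ a b c d e f) (lemma₂ a b c d e f)
    where
    lemma₁ : ∀ a b c d e f →
      a ℤ.* (c ℤ.+ e) ℤ.- b ℤ.* (d ℤ.+ f)
      ≡ (a ℤ.* c ℤ.- b ℤ.* d) ℤ.+ (a ℤ.* e ℤ.- b ℤ.* f)
    lemma₁ = solve-∀
    lemma₂ : ∀ a b c d e f →
      a ℤ.* (d ℤ.+ f) ℤ.+ b ℤ.* (c ℤ.+ e) ℤ.- b ℤ.* (d ℤ.+ f)
      ≡ (a ℤ.* d ℤ.+ b ℤ.* c ℤ.- b ℤ.* d) ℤ.+ (a ℤ.* f ℤ.+ b ℤ.* e ℤ.- b ℤ.* f)
    lemma₂ = solve-∀

D : CommutativeRing 0ℓ 0ℓ
D = record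
  { Carrier = ℤ[ω]
  ; _≈_     = _≡_
  ; _+_     = _+ᴰ_
  ; _*_     = _*ᴰ_
  ; -_      = -ᴰ_
  ; 0#      = 0ᴰ
  ; 1#      = 1ᴰ
  ; isCommutativeRing = record
    { isRing = record
      { +-isAbelianGroup = record
        { isGroup = record
          { isMonoid = record
            { isSemigroup = record
              { isMagma = record
                { isEquivalence = ≡.isEquivalence
                ; ∙-cong = cong₂ _+ᴰ_
                }
              ; assoc = +-assocᴰ
              }
            ; identity = comm∧idˡ⇒id +-commᴰ +-identityˡᴰ
            }
          ; inverse = comm∧invˡ⇒inv +-commᴰ -‿inverseˡᴰ
          ; ⁻¹-cong = ≡.cong -ᴰ_
          }
        ; comm = +-commᴰ
        }
      ; *-cong     = cong₂ _*ᴰ_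
      ; *-assoc    = *-assocᴰ
      ; *-identity = comm∧idˡ⇒id *-commᴰ *-identityˡᴰ
      ; distrib    = comm∧distrˡ⇒distr (cong₂ _+ᴰ_) *-commᴰ distribˡᴰ
      }
    ; *-comm = *-commᴰ
    }
  }
  where
  open import Algebra.Consequences.Propositional
    using (comm∧idˡ⇒id; comm∧invˡ⇒inv; comm∧distrˡ⇒distr)

open SemiringPrimality (CommutativeRing.semiring D) public using (Prime)

-- Write π = g(a + bω) with ua + vb = 1. The ideal πD, as a sublattice of
-- ℤ ⊕ ℤω, has the triangular basis g·N(a + bω), s + gω, where
-- s + gω = ((u + v) + uω)π. Hence the x + yω with 0 ≤ x < g·N(a + bω) and
-- 0 ≤ y < g are a complete system of residues, and there are
-- g²·N(a + bω) = Nπ of them. As π is prime, D/πD has no zero divisors, so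
-- multiplication by a nonzero element is injective, hence surjective.

module Submission where

open import Defs
open import Algebra.Bundles using (CommutativeRing; Semiring)
import Algebra.Properties.Ring as RingProperties
import Algebra.Properties.Semiring.Divisibility as SemiringDivisibility
import Algebra.Properties.Semiring.Primality as SemiringPrimality
open import Data.Fin.Base using (Fin; zero; suc; toℕ; fromℕ<; combine; remQuot)
import Data.Fin.Properties as Fin
open import Data.Integer.Base
  using (ℤ; +_; -[1+_]; 0ℤ; 1ℤ; _+_; _*_; _-_; -_; ∣_∣; _⊖_)
open import Data.Integer.Divisibility.Signed as ℤ∣
  using (divides) renaming (_∣_ to _∣ℤ_)
open import Data.Integer.DivMod using (_/ℕ_; n%ℕd<d; a≡a%ℕn+[a/ℕn]*n)
open import Data.Integer.GCD
  using (gcd; gcd[i,j]∣i; gcd[i,j]∣j; gcd[i,j]≡0⇒i≡0; gcd[i,j]≡0⇒j≡0)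
import Data.Integer.Properties as ℤ
open import Data.Integer.Tactic.RingSolver using (solve-∀)
open import Data.Nat.Base as ℕ using (ℕ; zero; suc; s<s; NonZero)
import Data.Nat.Divisibility as ℕ∣
import Data.Nat.GCD as ℕ
import Data.Nat.Properties as ℕ
open import Data.Product.Base using (_×_; _,_; ∃-syntax; ∃₂; proj₁; proj₂; uncurry)
open import Data.Sum.Base as Sum using (_⊎_; inj₁; inj₂)
open import Function.Base using (_∘_)
open import Function.Bundles using (Bijection)
open import Function.Definitions using (Injective; StrictlySurjective)
open import Level using (Level)
open import Relation.Binary.PropositionalEquality
  using (_≡_; _≢_; refl; sym; trans; cong; cong₂; subst; module ≡-Reasoning)
import Relation.Binary.Reasoning.Setoid as SetoidReasoning
open import Relation.Nullary.Negation using (contradiction)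

private
  variable
    c ℓ : Level
    n : ℕ

-- Finite integral domains are fields

injective⇒strictlySurjective : {f : Fin n → Fin n} →
  Injective _≡_ _≡_ f → StrictlySurjective _≡_ f
injective⇒strictlySurjective {n} {f} f-injective y
  -- Among the `n` values of `f` with `y` put in front, two coincide; injectivity of `f` forces `y`
  -- to be one of the two.
  with Fin.pigeonhole (ℕ.n<1+n n) (λ { zero → y ; (suc k) → f k })
... | zero  , suc j , _       , y≡fj  = j , sym y≡fj
... | suc i , suc j , s<s i<j , fi≡fj =
  contradiction (f-injective fi≡fj) (Fin.<⇒≢ i<j)

module _ (R : CommutativeRing c ℓ) where

  open CommutativeRing R
    using (0#; 1#; _≈_; _≉_; *-comm; ring; setoid)
    renaming (trans to ≈-trans; _*_ to _⊗_)
  open RingProperties ring using (x[y-z]≈xy-xz; x≈y⇒x∙y⁻¹≈ε; x∙y⁻¹≈ε⇒x≈y)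

  finiteDomain⇒field : 1# ≉ 0# →
    (∀ {x y} → x ⊗ y ≈ 0# → x ≈ 0# ⊎ y ≈ 0#) →
    HasCardinality setoid n → IsField R
  finiteDomain⇒field {n} 1≉0 noZeroDivisors card = record
    { 1≉0        = 1≉0
    ; invertible = invertible
    }
    where
    open Bijection card using (to; to⁻; injective; strictlySurjective)
    open SetoidReasoning setoid

    to∘to⁻ : ∀ x → to (to⁻ x) ≈ x
    to∘to⁻ x = proj₂ (strictlySurjective x)

    to⁻-injective : ∀ {x y} → to⁻ x ≡ to⁻ y → x ≈ y
    to⁻-injective {x} {y} eq = begin
      x           ≈⟨ to∘to⁻ x ⟨
      to (to⁻ x)  ≡⟨ cong to eq ⟩
      to (to⁻ y)  ≈⟨ to∘to⁻ y ⟩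
      y           ∎

    ⊗-cancelˡ : ∀ {x} → x ≉ 0# → ∀ y z → x ⊗ y ≈ x ⊗ z → y ≈ z
    ⊗-cancelˡ {x} x≉0 y z xy≈xz
      with noZeroDivisors (≈-trans (x[y-z]≈xy-xz x y z) (x≈y⇒x∙y⁻¹≈ε xy≈xz))
    ... | inj₁ x≈0   = contradiction x≈0 x≉0
    ... | inj₂ y-z≈0 = x∙y⁻¹≈ε⇒x≈y y z y-z≈0

    invertible : ∀ x → x ≉ 0# → ∃[ y ] (y ⊗ x ≈ 1#) × (x ⊗ y ≈ 1#)
    invertible x x≉0
      with k , eq ← injective⇒strictlySurjective
             -- Multiplication by `x`, transported to `Fin n`; the preimage of `to⁻ 1#` is the index
             -- of the inverse.
             {f = λ k → to⁻ (x ⊗ to k)}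
             (injective ∘ ⊗-cancelˡ x≉0 _ _ ∘ to⁻-injective)
             (to⁻ 1#)
      = to k , ≈-trans (*-comm (to k) x) xy≈1 , xy≈1
      where
      xy≈1 : x ⊗ to k ≈ 1#
      xy≈1 = to⁻-injective eq

-- Divisibility, and quotients by a prime

module _ (R : Semiring c ℓ) where

  open Semiring R using (setoid; +-cong; distribʳ; *-assoc; *-congˡ)
    renaming (_+_ to _⊕_; _*_ to _⊗_)
  open SemiringDivisibility R using (_∣_; _,_)
  open SetoidReasoning setoid

  ∣-linearCombination : ∀ {x y z} → x ∣ y → x ∣ z → ∀ r s → x ∣ (r ⊗ y ⊕ s ⊗ z)
  ∣-linearCombination {x} {y} {z} (p , px≈y) (q , qx≈z) r s = (r ⊗ p ⊕ s ⊗ q) , (begin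
    (r ⊗ p ⊕ s ⊗ q) ⊗ x          ≈⟨ distribʳ x (r ⊗ p) (s ⊗ q) ⟩
    (r ⊗ p) ⊗ x ⊕ (s ⊗ q) ⊗ x    ≈⟨ +-cong (*-assoc r p x) (*-assoc s q x) ⟩
    r ⊗ (p ⊗ x) ⊕ s ⊗ (q ⊗ x)    ≈⟨ +-cong (*-congˡ px≈y) (*-congˡ qx≈z) ⟩
    r ⊗ y ⊕ s ⊗ z                ∎)

module _ (R : CommutativeRing c ℓ) {p : CommutativeRing.Carrier R}
         (p-prime : SemiringPrimality.Prime (CommutativeRing.semiring R) p) where

  open CommutativeRing R using (0#; 1#; semiring; ring) renaming (_*_ to _⊗_; _-_ to _⊝_)
  open CommutativeRing (residueClassRing R p) using (_≈_; _≉_; setoid)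
  open SemiringDivisibility semiring using (_∣_; ∣-respʳ-≈)
  open SemiringPrimality semiring using () renaming (module Prime to PrimeElement)
  open PrimeElement p-prime using (p∤1; split-∣)

  private
    -- Being zero in the quotient unfolds to `p ∣ (x ⊝ 0#)`; this identity exchanges that for
    -- `p ∣ x`.
    x-0≈x : ∀ x → CommutativeRing._≈_ R (x ⊝ 0#) x
    x-0≈x x = ≈-trans (+-congˡ -0#≈0#) (+-identityʳ x)
      where
      open CommutativeRing R using (+-congˡ; +-identityʳ) renaming (trans to ≈-trans)
      open RingProperties ring using (-0#≈0#)

    ∣⇒≈0 : ∀ x → p ∣ x → x ≈ 0#
    ∣⇒≈0 x = ∣-respʳ-≈ (CommutativeRing.sym R (x-0≈x x))

    ≈0⇒∣ : ∀ x → x ≈ 0# → p ∣ x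
    ≈0⇒∣ x = ∣-respʳ-≈ (x-0≈x x)

    1≉0 : 1# ≉ 0#
    1≉0 = p∤1 ∘ ≈0⇒∣ 1#

    noZeroDivisors : ∀ {x y} → (x ⊗ y) ≈ 0# → x ≈ 0# ⊎ y ≈ 0#
    noZeroDivisors {x} {y} = Sum.map (∣⇒≈0 x) (∣⇒≈0 y) ∘ split-∣ ∘ ≈0⇒∣ (x ⊗ y)

  -- `p∤1` makes the quotient nontrivial and `split-∣` excludes zero divisors.
  finiteResidueClassRing⇒field : HasCardinality setoid n →
    IsField (residueClassRing R p)
  finiteResidueClassRing⇒field =
    finiteDomain⇒field (residueClassRing R p) 1≉0 (λ {x} {y} → noZeroDivisors {x} {y})

-- Bézout's identity over ℤ

ℕ-difference : ∀ {d} x m y n → d ℕ.+ y ℕ.* n ≡ x ℕ.* m →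
  + x * + m - + y * + n ≡ + d
ℕ-difference {d} x m y n d+yn≡xm = begin
  + x * + m - + y * + n               ≡⟨ cong₂ _-_ (ℤ.pos-* x m) (ℤ.pos-* y n) ⟨
  + (x ℕ.* m) - + (y ℕ.* n)           ≡⟨ cong (λ t → + t - + (y ℕ.* n)) d+yn≡xm ⟨
  + d + + (y ℕ.* n) - + (y ℕ.* n)     ≡⟨ lemma (+ d) (+ (y ℕ.* n)) ⟩
  + d                                 ∎
  where
  open ≡-Reasoning
  lemma : ∀ d t → d + t - t ≡ d
  lemma = solve-∀

bézout : ∀ i j → ∃₂ λ u v → u * i + v * j ≡ gcd i j
bézout i j
  -- `p` and `q` account for the signs: they turn coefficients for the absolute values into
  -- coefficients for `i` and `j`.
  with divides p ∣i∣≡pi ← ℤ∣.m∣∣m∣ {i} | divides q ∣j∣≡qj ← ℤ∣.m∣∣m∣ {j}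
  with ℕ.Bézout.identity (ℕ.gcd-GCD (∣ i ∣) (∣ j ∣))
... | ℕ.Bézout.+- x y eq = + x * p , - (+ y * q) , (begin
  + x * p * i + - (+ y * q) * j    ≡⟨ regroup (+ x) (+ y) p q i j ⟩
  + x * (p * i) - + y * (q * j)    ≡⟨ cong₂ (λ s t → + x * s - + y * t) ∣i∣≡pi ∣j∣≡qj ⟨
  + x * + ∣ i ∣ - + y * + ∣ j ∣    ≡⟨ ℕ-difference x (∣ i ∣) y (∣ j ∣) eq ⟩
  gcd i j                          ∎)
  where
  open ≡-Reasoning
  regroup : ∀ x y p q i j → x * p * i + - (y * q) * j ≡ x * (p * i) - y * (q * j)
  regroup = solve-∀
... | ℕ.Bézout.-+ x y eq = - (+ x * p) , + y * q , (begin
  - (+ x * p) * i + + y * q * j    ≡⟨ regroup (+ x) (+ y) p q i j ⟩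
  + y * (q * j) - + x * (p * i)    ≡⟨ cong₂ (λ s t → + y * t - + x * s) ∣i∣≡pi ∣j∣≡qj ⟨
  + y * + ∣ j ∣ - + x * + ∣ i ∣    ≡⟨ ℕ-difference y (∣ j ∣) x (∣ i ∣) eq ⟩
  gcd i j                          ∎)
  where
  open ≡-Reasoning
  regroup : ∀ x y p q i j → - (x * p) * i + y * q * j ≡ y * (q * j) - x * (p * i)
  regroup = solve-∀

-- Positive definiteness of the norm

i*i≡+∣i∣² : ∀ i → i * i ≡ + (∣ i ∣ ℕ.* ∣ i ∣)
i*i≡+∣i∣² (+ n)    = sym (ℤ.pos-* n n)
i*i≡+∣i∣² -[1+ n ] = refl

-- Completing the square, with the result as the image of a natural number so that nonnegativity and
-- the case of zero can be read off.
4N≡∣2a-b∣²+3∣b∣² : ∀ a b → + 4 * N (a +ω b) ≡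
  + (∣ + 2 * a - b ∣ ℕ.* ∣ + 2 * a - b ∣ ℕ.+ 3 ℕ.* (∣ b ∣ ℕ.* ∣ b ∣))
4N≡∣2a-b∣²+3∣b∣² a b = begin
  + 4 * N (a +ω b)
    ≡⟨ completeSquare a b ⟩
  (+ 2 * a - b) * (+ 2 * a - b) + + 3 * (b * b)
    ≡⟨ cong₂ (λ s t → s + + 3 * t) (i*i≡+∣i∣² (+ 2 * a - b)) (i*i≡+∣i∣² b) ⟩
  + (∣ + 2 * a - b ∣ ℕ.* ∣ + 2 * a - b ∣) + + 3 * + (∣ b ∣ ℕ.* ∣ b ∣)
    ≡⟨ cong (λ t → + (∣ + 2 * a - b ∣ ℕ.* ∣ + 2 * a - b ∣) + t)
              (ℤ.pos-* 3 (∣ b ∣ ℕ.* ∣ b ∣)) ⟨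
  + (∣ + 2 * a - b ∣ ℕ.* ∣ + 2 * a - b ∣ ℕ.+ 3 ℕ.* (∣ b ∣ ℕ.* ∣ b ∣)) ∎
  where
  open ≡-Reasoning
  completeSquare : ∀ a b → + 4 * (a * a - a * b + b * b) ≡
    (+ 2 * a - b) * (+ 2 * a - b) + + 3 * (b * b)
  completeSquare = solve-∀

+∣N∣≡N : ∀ α → + ∣ N α ∣ ≡ N α
+∣N∣≡N (a +ω b) with N (a +ω b) | 4N≡∣2a-b∣²+3∣b∣² a b
... | + n      | _ = refl
-- Four times a negative integer is negative, hence not of the form `+ k`.
... | -[1+ n ] | ()

N≡0⇒≡0 : ∀ α → N α ≡ 0ℤ → α ≡ 0ᴰ
N≡0⇒≡0 (a +ω b) N≡0 = cong₂ _+ω_ a≡0 b≡0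
  where
  -- A vanishing sum of naturals has vanishing summands, which gives `b≡0`; the norm then collapses
  -- to `a * a`.
  sum≡0 = ℤ.+-injective (trans (sym (4N≡∣2a-b∣²+3∣b∣² a b)) (cong (+ 4 *_) N≡0))

  i²≡0⇒i≡0 : ∀ i → ∣ i ∣ ℕ.* ∣ i ∣ ≡ 0 → i ≡ 0ℤ
  i²≡0⇒i≡0 i = ℤ.∣i∣≡0⇒i≡0 ∘ Sum.reduce ∘ ℕ.m*n≡0⇒m≡0∨n≡0 ∣ i ∣

  b≡0 : b ≡ 0ℤ
  b≡0 = i²≡0⇒i≡0 b (ℕ.*-cancelˡ-≡ (∣ b ∣ ℕ.* ∣ b ∣) 0 3
    (ℕ.m+n≡0⇒n≡0 (∣ + 2 * a - b ∣ ℕ.* ∣ + 2 * a - b ∣) sum≡0))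

  a≡0 : a ≡ 0ℤ
  a≡0 = Sum.reduce (ℤ.i*j≡0⇒i≡0∨j≡0 a (begin
    a * a                              ≡⟨ lemma a ⟩
    a * a - a * 0ℤ + 0ℤ * 0ℤ           ≡⟨ cong (λ b → N (a +ω b)) b≡0 ⟨
    N (a +ω b)                         ≡⟨ N≡0 ⟩
    0ℤ                                 ∎))
    where
    open ≡-Reasoning
    lemma : ∀ a → a * a ≡ a * a - a * 0ℤ + 0ℤ * 0ℤ
    lemma = solve-∀

-- Remainders of integers

∣∧<⇒≡0 : ∀ {m n} → n ℕ∣.∣ m → m ℕ.< n → m ≡ 0
∣∧<⇒≡0 {zero}  _   _   = refl
∣∧<⇒≡0 {suc _} n∣m m<n = contradiction n∣m (ℕ∣.>⇒∤ m<n)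

-- The difference lies strictly between `-n` and `n`, where 0 is the only multiple of `n`.
n∣i-j⇒i≡j : (i j : Fin n) → + n ∣ℤ + toℕ i - + toℕ j → i ≡ j
n∣i-j⇒i≡j {n} i j n∣i-j = Fin.toℕ-injective (ℤ.+-injective
  (ℤ.i-j≡0⇒i≡j (+ toℕ i) (+ toℕ j)
    (ℤ.∣i∣≡0⇒i≡0 (∣∧<⇒≡0 (ℤ∣.∣⇒∣ᵤ n∣i-j) ∣i-j∣<n))))
  where
  open ℕ.≤-Reasoning
  ∣i-j∣<n : ∣ + toℕ i - + toℕ j ∣ ℕ.< n
  ∣i-j∣<n = begin-strict
    ∣ + toℕ i - + toℕ j ∣  ≡⟨ cong ∣_∣ (ℤ.m-n≡m⊖n (toℕ i) (toℕ j)) ⟩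
    ∣ toℕ i ⊖ toℕ j ∣      ≤⟨ ℤ.∣m⊝n∣≤m⊔n (toℕ i) (toℕ j) ⟩
    toℕ i ℕ.⊔ toℕ j        <⟨ ℕ.⊔-lub (Fin.toℕ<n i) (Fin.toℕ<n j) ⟩
    n                      ∎

_mod_ : ∀ i n .{{_ : NonZero n}} → Fin n
i mod n = fromℕ< (n%ℕd<d i n)

i≡imodn+[i/n]*n : ∀ i n .{{_ : NonZero n}} → i ≡ + toℕ (i mod n) + (i /ℕ n) * + n
i≡imodn+[i/n]*n i n = trans (a≡a%ℕn+[a/ℕn]*n i n)
  (cong (λ r → + r + (i /ℕ n) * + n) (sym (Fin.toℕ-fromℕ< (n%ℕd<d i n))))

-- Counting residues with a triangular basis

module _ {π : ℤ[ω]} {m g : ℕ} .{{_ : NonZero m}} .{{_ : NonZero g}} {s : ℤ} where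

  open CommutativeRing (residueClassRing D π) using (_≈_; setoid)
    renaming (refl to ≈-refl; sym to ≈-sym)
  open SemiringDivisibility (CommutativeRing.semiring D)
    using () renaming (_∣_ to _∣ᴰ_)

  -- The first two hypotheses allow every element to be reduced into the `m` by `g` box; the last
  -- two keep distinct points of the box incongruent.
  triangularBasis⇒cardinality :
    π ∣ᴰ (+ m +ω 0ℤ) →
    π ∣ᴰ (s +ω + g) →
    (∀ {x y} → π ∣ᴰ (x +ω y) → + g ∣ℤ y) →
    (∀ {x} → π ∣ᴰ (x +ω 0ℤ) → + m ∣ℤ x) →
    HasCardinality setoid (m ℕ.* g)
  triangularBasis⇒cardinality π∣m π∣s+gω ∣⇒g∣y ∣⇒m∣x = record
    { to        = residue ∘ remQuot g
    ; cong      = λ { {k} refl → ≈-refl {residue (remQuot g k)} }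
    ; bijective = injective , surjective
    }
    where
    residue : Fin m × Fin g → ℤ[ω]
    residue (i , j) = + toℕ i +ω + toℕ j

    residue-injective : ∀ {p q} → residue p ≈ residue q → p ≡ q
    residue-injective {i , j} {i′ , j′} π∣p-q
      -- The ω-coefficients come first: `∣⇒m∣x` applies only once their difference is zero.
      with refl ← n∣i-j⇒i≡j j j′ (∣⇒g∣y π∣p-q)
      with refl ← n∣i-j⇒i≡j i i′
        (∣⇒m∣x (subst (λ y → π ∣ᴰ (+ toℕ i - + toℕ i′ +ω y))
          (ℤ.+-inverseʳ (+ toℕ j)) π∣p-q))
      = refl

    injective : ∀ {k l} → residue (remQuot g k) ≈ residue (remQuot g l) → k ≡ l
    injective {k} {l} eq = begin
      k
        ≡⟨ Fin.combine-remQuot {m} g k ⟨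
      uncurry combine (remQuot {m} g k)
        ≡⟨ cong (uncurry combine) (residue-injective {remQuot g k} {remQuot g l} eq) ⟩
      uncurry combine (remQuot {m} g l)
        ≡⟨ Fin.combine-remQuot {m} g l ⟩
      l ∎
      where open ≡-Reasoning

    -- The difference of the two sides is `r` times `m` plus `q` times `s + gω`, both multiples of
    -- `π`.
    reduce : ∀ {x y} i j q r → x ≡ i + r * + m + q * s → y ≡ j + q * + g →
      (x +ω y) ≈ (i +ω j)
    reduce {x} {y} i j q r refl refl = subst (π ∣ᴰ_)
      (cong₂ _+ω_ (lemma₁ i r (+ m) q s (+ g)) (lemma₂ j r (+ m) q s (+ g)))
      (∣-linearCombination (CommutativeRing.semiring D)
        {π} {+ m +ω 0ℤ} {s +ω + g} π∣m π∣s+gω (r +ω 0ℤ) (q +ω 0ℤ))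
      where
      lemma₁ : ∀ i r m q s g →
        (r * m - 0ℤ * 0ℤ) + (q * s - 0ℤ * g) ≡ i + r * m + q * s - i
      lemma₁ = solve-∀
      lemma₂ : ∀ j r m q s g →
        (r * 0ℤ + 0ℤ * m - 0ℤ * 0ℤ) + (q * g + 0ℤ * s - 0ℤ * g) ≡ j + q * g - j
      lemma₂ = solve-∀

    representative : ∀ α → ∃[ p ] α ≈ residue p
    representative (x +ω y) = (i , j) , reduce (+ toℕ i) (+ toℕ j) q r x≡ y≡
      where
      -- Subtracting `q` copies of `s + gω` reduces `y` but also shifts `x` by `q * s`, so it is
      -- `x - q * s` that gets divided by `m`.
      q = y /ℕ g
      j = y mod g
      r = (x - q * s) /ℕ m
      i = (x - q * s) mod m

      y≡ : y ≡ + toℕ j + q * + g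
      y≡ = i≡imodn+[i/n]*n y g

      x≡ : x ≡ + toℕ i + r * + m + q * s
      x≡ = begin
        x                              ≡⟨ lemma x (q * s) ⟩
        (x - q * s) + q * s            ≡⟨ cong (_+ q * s) (i≡imodn+[i/n]*n (x - q * s) m) ⟩
        + toℕ i + r * + m + q * s      ∎
        where
        open ≡-Reasoning
        lemma : ∀ x t → x ≡ (x - t) + t
        lemma = solve-∀

    surjective : ∀ α → ∃[ k ] (∀ {l} → l ≡ k → residue (remQuot g l) ≈ α)
    surjective α with (i , j) , α≈ij ← representative α = combine i j , λ
      { refl → subst (λ p → residue p ≈ α) (sym (Fin.remQuot-combine i j)) (≈-sym {α} α≈ij) }

-- The triangular basis of the ideal generated by π

HasNormManyResidues : ℤ[ω] → Set
HasNormManyResidues π = ∃[ n ] + n ≡ N π ×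
  HasCardinality (CommutativeRing.setoid (residueClassRing D π)) n

module _ {a b u v : ℤ} (g : ℕ) .{{_ : NonZero g}} (ua+vb≡1 : u * a + v * b ≡ 1ℤ) where

  open SemiringDivisibility (CommutativeRing.semiring D)
    using (_,_) renaming (_∣_ to _∣ᴰ_)
  open ≡-Reasoning

  private
    π : ℤ[ω]
    π = a * + g +ω b * + g

    m : ℕ
    m = ∣ N (a +ω b) ∣ ℕ.* g

    -- The coefficient of 1 in `((u + v) + uω)π`, spelled exactly as the product unfolds, so that it
    -- agrees by definition in `π∣s+gω`.
    s : ℤ
    s = (u + v) * (a * + g) - u * (b * + g)

    +m≡Ng : + m ≡ N (a +ω b) * + g
    +m≡Ng = trans (ℤ.pos-* ∣ N (a +ω b) ∣ g) (cong (_* + g) (+∣N∣≡N (a +ω b)))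

    -- If `a` and `b` were both zero, `ua+vb≡1` would read 0 = 1.
    N≢0 : N (a +ω b) ≢ 0ℤ
    N≢0 N≡0 with refl ← N≡0⇒≡0 (a +ω b) N≡0 =
      contradiction (trans (sym ua+vb≡1) (lemma u v)) λ ()
      where
      lemma : ∀ u v → u * 0ℤ + v * 0ℤ ≡ 0ℤ
      lemma = solve-∀

    instance
      ∣N∣-nonZero : NonZero ∣ N (a +ω b) ∣
      ∣N∣-nonZero = ℕ.≢-nonZero (N≢0 ∘ ℤ.∣i∣≡0⇒i≡0)

      m-nonZero : NonZero m
      m-nonZero = ℕ.m*n≢0 ∣ N (a +ω b) ∣ g

    mg≡Nπ : + (m ℕ.* g) ≡ N π
    mg≡Nπ = begin
      + (m ℕ.* g)                ≡⟨ ℤ.pos-* m g ⟩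
      + m * + g                  ≡⟨ cong (_* + g) +m≡Ng ⟩
      N (a +ω b) * + g * + g     ≡⟨ lemma a b (+ g) ⟩
      N π                        ∎
      where
      lemma : ∀ a b g → (a * a - a * b + b * b) * g * g ≡
        a * g * (a * g) - a * g * (b * g) + b * g * (b * g)
      lemma = solve-∀

    π∣m : π ∣ᴰ (+ m +ω 0ℤ)
    -- `π` is `g` times `a + bω`, whose product with its conjugate is its norm.
    π∣m = conj (a +ω b) , cong₂ _+ω_ (trans (lemma₁ a b (+ g)) (sym +m≡Ng)) (lemma₂ a b (+ g))
      where
      lemma₁ : ∀ a b g → (a - b) * (a * g) - (- b) * (b * g) ≡ (a * a - a * b + b * b) * g
      lemma₁ = solve-∀
      lemma₂ : ∀ a b g → (a - b) * (b * g) + (- b) * (a * g) - (- b) * (b * g) ≡ 0ℤ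
      lemma₂ = solve-∀

    π∣s+gω : π ∣ᴰ (s +ω + g)
    -- The ω-coefficient of `(p + qω)(a + bω)` is `qa + (p - q)b`; the choice `q = u`, `p - q = v`
    -- makes it `ua + vb`, which is 1.
    π∣s+gω = (u + v +ω u) , cong (s +ω_) (begin
      (u + v) * (b * + g) + u * (a * + g) - u * (b * + g)  ≡⟨ lemma a b u v (+ g) ⟩
      (u * a + v * b) * + g                                ≡⟨ cong (_* + g) ua+vb≡1 ⟩
      1ℤ * + g                                             ≡⟨ ℤ.*-identityˡ (+ g) ⟩
      + g                                                  ∎)
      where
      lemma : ∀ a b u v g →
        (u + v) * (b * g) + u * (a * g) - u * (b * g) ≡ (u * a + v * b) * g
      lemma = solve-∀

    -- The left side is the ω-coefficient of `(p + qω)π`. The factor `g` shows divisibility, and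
    -- cancelling it gives `y/g≡0`.
    coeff-ω-multiple : ∀ p q → p * (b * + g) + q * (a * + g) - q * (b * + g) ≡
                               (p * b + q * a - q * b) * + g
    coeff-ω-multiple p q = lemma a b p q (+ g)
      where
      lemma : ∀ a b p q g →
        p * (b * g) + q * (a * g) - q * (b * g) ≡ (p * b + q * a - q * b) * g
      lemma = solve-∀

    π∣x+yω⇒g∣y : ∀ {x y} → π ∣ᴰ (x +ω y) → + g ∣ℤ y
    π∣x+yω⇒g∣y ((p +ω q) , refl) = divides (p * b + q * a - q * b) (coeff-ω-multiple p q)

    π∣x⇒m∣x : ∀ {x} → π ∣ᴰ (x +ω 0ℤ) → + m ∣ℤ x
    π∣x⇒m∣x {x} ((p +ω q) , eq) = divides k (begin
      x                                        ≡⟨ cong ℤ[ω].coeff-1 eq ⟨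
      p * (a * + g) - q * (b * + g)            ≡⟨ lemma₁ a b p q (+ g) ⟩
      -- Once 1 is replaced by `u * a + v * b`, a polynomial identity splits the product into a
      -- multiple of the vanishing ω-coefficient and `k` times the norm.
      (p * a - q * b) * 1ℤ * + g               ≡⟨ cong (λ t → (p * a - q * b) * t * + g) ua+vb≡1 ⟨
      (p * a - q * b) * (u * a + v * b) * + g  ≡⟨ cong (_* + g) (lemma₂ a b u v p q) ⟩
      ((p * b + q * a - q * b) * (a * v + (a - b) * u) + k * N (a +ω b)) * + g
        ≡⟨ cong (λ t → (t * (a * v + (a - b) * u) + k * N (a +ω b)) * + g) y/g≡0 ⟩
      (0ℤ * (a * v + (a - b) * u) + k * N (a +ω b)) * + g
        ≡⟨ lemma₃ (a * v + (a - b) * u) k (N (a +ω b)) (+ g) ⟩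
      k * (N (a +ω b) * + g)                   ≡⟨ cong (k *_) +m≡Ng ⟨
      k * + m                                  ∎)
      where
      -- The ω-coefficient qa + (p − q)b of (p + qω)(a + bω) vanishes and a, b
      -- are coprime, so q = −kb and p − q = ka; k is recovered by ua + vb = 1.
      k = u * (p - q) - v * q

      y/g≡0 : p * b + q * a - q * b ≡ 0ℤ
      y/g≡0 = ℤ.*-cancelʳ-≡ _ 0ℤ (+ g) (trans (sym (coeff-ω-multiple p q)) (cong ℤ[ω].coeff-ω eq))

      lemma₁ : ∀ a b p q g → p * (a * g) - q * (b * g) ≡ (p * a - q * b) * 1ℤ * g
      lemma₁ = solve-∀
      lemma₂ : ∀ a b u v p q → (p * a - q * b) * (u * a + v * b) ≡
        (p * b + q * a - q * b) * (a * v + (a - b) * u) +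
        (u * (p - q) - v * q) * (a * a - a * b + b * b)
      lemma₂ = solve-∀
      lemma₃ : ∀ t k n g → (0ℤ * t + k * n) * g ≡ k * (n * g)
      lemma₃ = solve-∀

  multipleOfPrimitive⇒normManyResidues : HasNormManyResidues (a * + g +ω b * + g)
  multipleOfPrimitive⇒normManyResidues = m ℕ.* g , mg≡Nπ ,
    triangularBasis⇒cardinality {π} {m} {g} {s = s}
      π∣m π∣s+gω π∣x+yω⇒g∣y π∣x⇒m∣x

-- Extracting the gcd of the coefficients

-- Matching the divisibility proofs turns `i` and `j` into literal multiples of `g`; cancelling `g`
-- in the Bézout relation shows the quotients coprime.
bézout⇒normManyResidues : ∀ {i j u v} g .{{_ : NonZero g}} →
  + g ∣ℤ i → + g ∣ℤ j → u * i + v * j ≡ + g → HasNormManyResidues (i +ω j)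
bézout⇒normManyResidues {u = u} {v} g (divides a refl) (divides b refl) ui+vj≡g =
  multipleOfPrimitive⇒normManyResidues {a} {b} {u} {v} g
    (ℤ.*-cancelʳ-≡ (u * a + v * b) 1ℤ (+ g) (begin
      (u * a + v * b) * + g           ≡⟨ lemma a b u v (+ g) ⟩
      u * (a * + g) + v * (b * + g)   ≡⟨ ui+vj≡g ⟩
      + g                             ≡⟨ ℤ.*-identityˡ (+ g) ⟨
      1ℤ * + g                        ∎))
  where
  open ≡-Reasoning
  lemma : ∀ a b u v g → (u * a + v * b) * g ≡ u * (a * g) + v * (b * g)
  lemma = solve-∀

nonZero⇒normManyResidues : ∀ π → π ≢ 0ᴰ → HasNormManyResidues π
nonZero⇒normManyResidues (i +ω j) π≢0 =
  bézout⇒normManyResidues {i} {j} {proj₁ ∃uv} {proj₁ (proj₂ ∃uv)}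
    (ℕ.gcd (∣ i ∣) (∣ j ∣)) {{ℕ.≢-nonZero gcd≢0}}
    (ℤ∣.∣ᵤ⇒∣ (gcd[i,j]∣i i j)) (ℤ∣.∣ᵤ⇒∣ (gcd[i,j]∣j i j)) (proj₂ (proj₂ ∃uv))
  where
  ∃uv = bézout i j

  gcd≢0 : ℕ.gcd (∣ i ∣) (∣ j ∣) ≢ 0
  gcd≢0 gcd≡0 = π≢0 (cong₂ _+ω_
    (gcd[i,j]≡0⇒i≡0 i j (cong +_ gcd≡0)) (gcd[i,j]≡0⇒j≡0 {i} {j} (cong +_ gcd≡0)))

theorem3p5 : (π : ℤ[ω]) → Prime π →
    IsField (residueClassRing D π) ×
    (∃[ n ] + n ≡ N π × HasCardinality (CommutativeRing.setoid (residueClassRing D π)) n)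
theorem3p5 π π-prime =
  finiteResidueClassRing⇒field D π-prime (proj₂ (proj₂ residues)) , residues
  where
  residues : HasNormManyResidues π
  residues = nonZero⇒normManyResidues π (Prime.p≉0 π-prime)
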